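{- There is an absolute constant $C>0$ such that for arbitrarily large positive integers $N$ there exist a non-periodic tiling $\mathbb{Z}_N=A\oplus B$ and additional distinct non-periodic tiling complements $B_1,\dots,B_k$ of $A$ in $\mathbb{Z}_N$ (that is, pairwise distinct non-periodic sets, all different from $B$, with $\mathbb{Z}_N=A\oplus B_i$ for each $i$), where $k\ge e^{C\sqrt{N}}$.
   Context: $\mathbb{Z}_N=\mathbb{Z}/N\mathbb{Z}$. For subsets $A,B$ of an abelian group $G$, $G=A\oplus B$ means that every $g\in G$ has a unique representation $g=a+b$ with $a\in A$, $b\in B$; then $A$ and $B$ are called tiling complements of each other and $G = A\oplus B$ is called a tiling. A set $B\subseteq G$ is periodic if there is a nonzero $g\in G$ with $B+g=B$, and non-periodic otherwise. A tiling $G=A\oplus B$ is non-periodic if neither $A$ nor $B$ is periodic. -}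

module Defs where

open import Algebra.Bundles using (AbelianGroup)
import Algebra.Definitions.RawSemiring as RawSemiringDefs
open import Data.Fin.Base using (Fin; toℕ)
open import Data.Fin.Properties using (toℕ-injective; toℕ-fromℕ<; toℕ<n; toℕ≤n)
open import Data.Integer.Base using (+_)
open import Data.Nat.Base as ℕ using (ℕ; zero; suc; NonZero; _!)
open import Data.Nat.DivMod
  using (_%_; _mod_; m%n<n; m%n%n≡m%n; m<n⇒m%n≡m; n%n≡0; %-distribˡ-+)
import Data.Nat.Properties as ℕₚ
open import Data.Product using (∃; ∃!; _×_; _,_)
open import Data.Product.Relation.Binary.Pointwise.NonDependent using (Pointwise)
open import Data.Rational.Base using (ℚ; 0ℚ; _/_; _+_; _*_; _≤_; +-*-rawSemiring)
open import Level using (0ℓ)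
open import Relation.Binary.PropositionalEquality
open import Relation.Nullary using (¬_)
open import Relation.Unary using (Pred; _∈_; _≐_)

-- Subsets of G are predicates; they are meant to respect _≈_, which is
-- automatic for ℤ/ N below, where _≈_ is _≡_.

module _ {c ℓ} (G : AbelianGroup c ℓ) where
  open AbelianGroup G

  Tiling : ∀ {p q} → Pred Carrier p → Pred Carrier q → Set _
  Tiling A B = ∀ g →
    ∃! (Pointwise _≈_ _≈_) λ (a , b) → a ∈ A × b ∈ B × g ≈ a ∙ b

  Translate : ∀ {p} → Pred Carrier p → Carrier → Pred Carrier _
  Translate B g x = ∃ λ b → b ∈ B × x ≈ b ∙ g

  Periodic : ∀ {p} → Pred Carrier p → Set _
  Periodic B = ∃ λ g → ¬ g ≈ ε × Translate B g ≐ B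

  NonPeriodic : ∀ {p} → Pred Carrier p → Set _
  NonPeriodic B = ¬ Periodic B

  NonPeriodicTiling : ∀ {p q} → Pred Carrier p → Pred Carrier q → Set _
  NonPeriodicTiling A B = Tiling A B × NonPeriodic A × NonPeriodic B

module _ (N : ℕ) .{{_ : NonZero N}} where
  open ≡-Reasoning

  private
    toℕ-mod : ∀ m → toℕ (m mod N) ≡ m % N
    toℕ-mod m = toℕ-fromℕ< (m%n<n m N)

    %-absorbˡ : ∀ m n → (m % N ℕ.+ n) % N ≡ (m ℕ.+ n) % N
    %-absorbˡ m n = begin
      (m % N ℕ.+ n) % N          ≡⟨ %-distribˡ-+ (m % N) n N ⟩
      (m % N % N ℕ.+ n % N) % N  ≡⟨ cong (λ t → (t ℕ.+ n % N) % N) (m%n%n≡m%n m N) ⟩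
      (m % N ℕ.+ n % N) % N      ≡⟨ %-distribˡ-+ m n N ⟨
      (m ℕ.+ n) % N              ∎

    %-absorbʳ : ∀ m n → (m ℕ.+ n % N) % N ≡ (m ℕ.+ n) % N
    %-absorbʳ m n = begin
      (m ℕ.+ n % N) % N  ≡⟨ cong (_% N) (ℕₚ.+-comm m (n % N)) ⟩
      (n % N ℕ.+ m) % N  ≡⟨ %-absorbˡ n m ⟩
      (n ℕ.+ m) % N      ≡⟨ cong (_% N) (ℕₚ.+-comm n m) ⟩
      (m ℕ.+ n) % N      ∎

    infixl 6 _⊕_
    _⊕_ : Fin N → Fin N → Fin N
    a ⊕ b = (toℕ a ℕ.+ toℕ b) mod N

    ⊖_ : Fin N → Fin N
    ⊖ a = (N ℕ.∸ toℕ a) mod N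

    toℕ-⊕ : ∀ a b → toℕ (a ⊕ b) ≡ (toℕ a ℕ.+ toℕ b) % N
    toℕ-⊕ a b = toℕ-mod (toℕ a ℕ.+ toℕ b)

    ⊕-comm : ∀ a b → a ⊕ b ≡ b ⊕ a
    ⊕-comm a b = cong (λ m → m mod N) (ℕₚ.+-comm (toℕ a) (toℕ b))

    ⊕-assoc : ∀ a b c → (a ⊕ b) ⊕ c ≡ a ⊕ (b ⊕ c)
    ⊕-assoc a b c = toℕ-injective (begin
      toℕ (a ⊕ b ⊕ c)                          ≡⟨ toℕ-⊕ (a ⊕ b) c ⟩
      (toℕ (a ⊕ b) ℕ.+ toℕ c) % N              ≡⟨ cong (λ t → (t ℕ.+ toℕ c) % N) (toℕ-⊕ a b) ⟩
      ((toℕ a ℕ.+ toℕ b) % N ℕ.+ toℕ c) % N    ≡⟨ %-absorbˡ (toℕ a ℕ.+ toℕ b) (toℕ c) ⟩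
      (toℕ a ℕ.+ toℕ b ℕ.+ toℕ c) % N          ≡⟨ cong (_% N) (ℕₚ.+-assoc (toℕ a) (toℕ b) (toℕ c)) ⟩
      (toℕ a ℕ.+ (toℕ b ℕ.+ toℕ c)) % N        ≡⟨ %-absorbʳ (toℕ a) (toℕ b ℕ.+ toℕ c) ⟨
      (toℕ a ℕ.+ (toℕ b ℕ.+ toℕ c) % N) % N    ≡⟨ cong (λ t → (toℕ a ℕ.+ t) % N) (toℕ-⊕ b c) ⟨
      (toℕ a ℕ.+ toℕ (b ⊕ c)) % N              ≡⟨ toℕ-⊕ a (b ⊕ c) ⟨
      toℕ (a ⊕ (b ⊕ c))                        ∎)

    ⊕-identityˡ : ∀ a → (0 mod N) ⊕ a ≡ a
    ⊕-identityˡ a = toℕ-injective (begin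
      toℕ ((0 mod N) ⊕ a)          ≡⟨ toℕ-⊕ (0 mod N) a ⟩
      (toℕ (0 mod N) ℕ.+ toℕ a) % N  ≡⟨ cong (λ t → (t ℕ.+ toℕ a) % N) (toℕ-mod 0) ⟩
      (0 % N ℕ.+ toℕ a) % N        ≡⟨ %-absorbˡ 0 (toℕ a) ⟩
      toℕ a % N                    ≡⟨ m<n⇒m%n≡m (toℕ<n a) ⟩
      toℕ a                        ∎)

    ⊖-inverseˡ : ∀ a → (⊖ a) ⊕ a ≡ 0 mod N
    ⊖-inverseˡ a = toℕ-injective (begin
      toℕ ((⊖ a) ⊕ a)                      ≡⟨ toℕ-⊕ (⊖ a) a ⟩
      (toℕ (⊖ a) ℕ.+ toℕ a) % N            ≡⟨ cong (λ t → (t ℕ.+ toℕ a) % N) (toℕ-mod (N ℕ.∸ toℕ a)) ⟩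
      ((N ℕ.∸ toℕ a) % N ℕ.+ toℕ a) % N    ≡⟨ %-absorbˡ (N ℕ.∸ toℕ a) (toℕ a) ⟩
      (N ℕ.∸ toℕ a ℕ.+ toℕ a) % N          ≡⟨ cong (_% N) (ℕₚ.m∸n+n≡m (toℕ≤n a)) ⟩
      N % N                                ≡⟨ n%n≡0 N ⟩
      0                                    ≡⟨ m<n⇒m%n≡m (ℕ.>-nonZero⁻¹ N) ⟨
      0 % N                                ≡⟨ toℕ-mod 0 ⟨
      toℕ (0 mod N)                        ∎)

  ℤ/_ : AbelianGroup 0ℓ 0ℓ
  ℤ/_ = record
    { Carrier = Fin N
    ; _≈_     = _≡_
    ; _∙_     = _⊕_
    ; ε       = 0 mod N
    ; _⁻¹     = ⊖_
    ; isAbelianGroup = record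
      { isGroup = record
        { isMonoid = record
          { isSemigroup = record
            { isMagma = record { isEquivalence = isEquivalence ; ∙-cong = cong₂ _⊕_ }
            ; assoc   = ⊕-assoc
            }
          ; identity = ⊕-identityˡ , λ a → trans (⊕-comm a (0 mod N)) (⊕-identityˡ a)
          }
        ; inverse = ⊖-inverseˡ , λ a → trans (⊕-comm a (⊖ a)) (⊖-inverseˡ a)
        ; ⁻¹-cong = cong ⊖_
        }
      ; comm = ⊕-comm
      }
    }

fromℕ : ℕ → ℚ
fromℕ n = + n / 1

open RawSemiringDefs +-*-rawSemiring using (_^_)

-- expSum x n = ∑_{i<n} xⁱ/i!

expSum : ℚ → ℕ → ℚ
expSum x zero    = 0ℚ
expSum x (suc n) = expSum x n + x ^ n * (_/_ (+ 1) (n !) {{ℕₚ._!≢0 n}})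

-- A nonnegative real number is represented by its set of nonnegative
-- rational lower bounds.  For C ≥ 0, a rational r ≥ 0 satisfies r ≤ C√n
-- exactly when r² ≤ C²n.  As C√n increases with C, a bound
-- e^(C√n) ≤ q for a real C > 0 holds for any smaller rational C > 0 as well,
-- so an existentially quantified C may be taken rational.

_√_ : ℚ → ℕ → Pred ℚ 0ℓ
(C √ n) r = 0ℚ ≤ r × r * r ≤ (C * C) * fromℕ n

-- For real x ≥ 0, eˣ is the supremum of the partial sums ∑_{i<n} rⁱ/i! over
-- all n and all rational 0 ≤ r ≤ x; eˣ ≤ q says that q is an upper bound of
-- these sums.

exp_≤_ : Pred ℚ 0ℓ → ℚ → Set
exp x ≤ q = ∀ {r} → r ∈ x → ∀ n → expSum r n ≤ q

{-# OPTIONS --safe #-}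
-- By the Chinese remainder theorem ℤ/8ℓ is ℤ/8 × ℤ/ℓ, where ℓ = 24w + 33 ≡ 1 mod 8.
-- There A = {0,2} × {0,1,2} is complemented by the set B which consists of (1,3j),
-- (5,3j+1) and, for every j, of (2s(j),3j) and (4+2s(j),3j), whatever s : j ↦ {0,1} is:
-- over the even residues mod 8 a decomposition is found from its ℤ/ℓ component first,
-- over the odd ones from its ℤ/8 component first.  The odd part of B only has the periods
-- (0,3j), and these are no periods of the even part if s(0) = 1 and s is supported on
-- less than half of the rows.  The remaining freedom in s gives 2ʷ complements, and
-- ℓ is linear in w.
--
-- For 0 ≤ r ≤ m the terms rⁱ/i! are at most (2m)²ᵐ/2ⁱ, so eʳ ≤ 2(2m)²ᵐ ≤ 2ʷ for
-- w = 4m² + 1, and then N = 8ℓ ≤ (35m)².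
module Submission where

open import Defs
open import Algebra.Bundles using (AbelianGroup)
import Algebra.Definitions.RawSemiring as RawSemiringDefs
open import Algebra.Properties.Group using (x≈z//y; //-rightDividesˡ)
open import Data.Bool.Base using (Bool; true; false)
import Data.Bool.Properties as Bool
open import Data.Fin.Base using (Fin; zero; suc; toℕ; fromℕ<; finToFun; funToFin; combine)
open import Data.Fin.Patterns
open import Data.Fin.Properties
  using (all?; any?; _≟_; toℕ-injective; toℕ-fromℕ<; toℕ<n; fromℕ<-toℕ; funToFin-finToFin)
open import Data.Fin.Subset using (Subset; _∈_)
open import Data.Integer.Base as ℤ using (+_)
import Data.Integer.Properties as ℤₚ
open import Data.Nat.Base as ℕ using (ℕ; zero; suc; NonZero; _!)
open import Data.Nat.Divisibility using (_∣_; divides; ∣-trans)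
open import Data.Nat.DivMod
  using (_%_; _mod_; m%n<n; m%n≤m; m<n⇒m%n≡m; m∣n⇒o%n%m≡o%m; m≡m%n+[m/n]*n; m*n%n≡0; m*n/n≡m;
         %-distribˡ-+; [m+kn]%n≡m%n)
import Data.Nat.Properties as ℕₚ
open import Data.Nat.Tactic.RingSolver using (solve-∀)
open import Data.Product using (Σ-syntax; ∃; ∃₂; _×_; _,_; proj₁; proj₂)
open import Data.Rational.Base using (ℚ; 0ℚ; _<_)
import Data.Rational.Properties as ℚₚ
import Data.Rational.Solver as ℚ-Solver
import Data.Rational.Unnormalised.Base as ℚᵘ
import Data.Rational.Unnormalised.Properties as ℚᵘₚ
open import Data.Sum.Base using (inj₁; inj₂)
open import Data.Vec.Base using (lookup; tabulate; _∷_; [])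
open import Data.Vec.Properties using (lookup∘tabulate; []=⇒lookup; lookup⇒[]=)
open import Function.Base using (id)
open import Function.Definitions using (Injective)
open import Relation.Binary.PropositionalEquality
open import Relation.Nullary using (¬_; Dec; does; yes; no; contradiction)
open import Relation.Nullary.Decidable using (from-yes; _→-dec_; _×-dec_; dec-true)
open import Relation.Unary using (Pred; Decidable; _≐_)

module Tilings where
  open import Data.Nat.Base using (_+_; _*_; _≤_)
  open import Data.Nat.DivMod using (_/_)

  private variable
    n N : ℕ

  -- Cyclic groups and the reduction maps between them.

  infixl 6 _⊞_ _⊟_

  _⊞_ _⊟_ : .{{_ : NonZero n}} → Fin n → Fin n → Fin n
  _⊞_ {n} = AbelianGroup._∙_ (ℤ/ n)
  _⊟_ {n} x y = x ⊞ AbelianGroup._⁻¹ (ℤ/ n) y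

  ⊟-⊞ : .{{_ : NonZero n}} (x y : Fin n) → (x ⊟ y) ⊞ y ≡ x
  ⊟-⊞ {n} x y = //-rightDividesˡ (AbelianGroup.group (ℤ/ n)) y x

  ⊞≡⇒≡⊟ : .{{_ : NonZero n}} (x y : Fin n) {z : Fin n} → x ⊞ y ≡ z → x ≡ z ⊟ y
  ⊞≡⇒≡⊟ {n} x y = x≈z//y (AbelianGroup.group (ℤ/ n)) x y _

  ⊞-comm : .{{_ : NonZero n}} (x y : Fin n) → x ⊞ y ≡ y ⊞ x
  ⊞-comm {n} = AbelianGroup.comm (ℤ/ n)

  toℕ-mod : .{{_ : NonZero n}} → ∀ k → toℕ (k mod n) ≡ k % n
  toℕ-mod {n} k = toℕ-fromℕ< (m%n<n k n)

  %⇒mod : .{{_ : NonZero n}} → ∀ {k l} → k % n ≡ l % n → k mod n ≡ l mod n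
  %⇒mod {k = k} {l} eq = toℕ-injective (trans (toℕ-mod k) (trans eq (sym (toℕ-mod l))))

  toℕ-mod-inverse : .{{_ : NonZero n}} (x : Fin n) → toℕ x mod n ≡ x
  toℕ-mod-inverse x = toℕ-injective (trans (toℕ-mod (toℕ x)) (m<n⇒m%n≡m (toℕ<n x)))

  mod-+ : .{{_ : NonZero n}} → ∀ k l → (k + l) mod n ≡ (k mod n) ⊞ (l mod n)
  mod-+ {n} k l = toℕ-injective (begin
    toℕ ((k + l) mod n)                    ≡⟨ toℕ-mod (k + l) ⟩
    (k + l) % n                            ≡⟨ %-distribˡ-+ k l n ⟩
    (k % n + l % n) % n                    ≡⟨ cong₂ (λ a b → (a + b) % n) (toℕ-mod k) (toℕ-mod l) ⟨
    (toℕ (k mod n) + toℕ (l mod n)) % n    ≡⟨ toℕ-mod (toℕ (k mod n) + toℕ (l mod n)) ⟨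
    toℕ ((k mod n) ⊞ (l mod n))            ∎)
    where open ≡-Reasoning

  -- Representatives whose sum stays below `n` add without wrapping around, so the sum vanishes
  -- already in ℕ. This is how small coordinates rule out periods below.
  ⊞≡0⇒≡0 : .{{_ : NonZero n}} (x y : Fin n) →
           x ⊞ y ≡ 0 mod n → toℕ x + toℕ y ℕ.< n → toℕ x ≡ 0 × toℕ y ≡ 0
  ⊞≡0⇒≡0 {n} x y eq lt = ℕₚ.m+n≡0⇒m≡0 _ sum≡0 , ℕₚ.m+n≡0⇒n≡0 (toℕ x) sum≡0
    where
    open ≡-Reasoning
    sum≡0 : toℕ x + toℕ y ≡ 0
    sum≡0 = begin
      toℕ x + toℕ y         ≡⟨ m<n⇒m%n≡m lt ⟨
      (toℕ x + toℕ y) % n   ≡⟨ toℕ-mod (toℕ x + toℕ y) ⟨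
      toℕ (x ⊞ y)           ≡⟨ cong toℕ eq ⟩
      toℕ (0 mod n)         ≡⟨ toℕ-mod 0 ⟩
      0 % n                 ≡⟨ m<n⇒m%n≡m (ℕ.>-nonZero⁻¹ n) ⟩
      0                     ∎

  π : ∀ n .{{_ : NonZero n}} → Fin N → Fin n
  π n x = toℕ x mod n

  module _ .{{_ : NonZero n}} .{{_ : NonZero N}} (n∣N : n ∣ N) where

    π-mod : ∀ k → π n (k mod N) ≡ k mod n
    π-mod k = %⇒mod (trans (cong (_% n) (toℕ-mod k)) (m∣n⇒o%n%m≡o%m n N k n∣N))

    π-⊞ : ∀ x y → π n (x ⊞ y) ≡ π n x ⊞ π n y
    π-⊞ x y = trans (π-mod (toℕ x + toℕ y)) (mod-+ (toℕ x) (toℕ y))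

    π-⊟ : ∀ x y → π n (x ⊟ y) ≡ π n x ⊟ π n y
    π-⊟ x y = ⊞≡⇒≡⊟ _ _ (trans (sym (π-⊞ (x ⊟ y) y)) (cong (π n) (⊟-⊞ x y)))

  -- Invariance under equality of sets, a criterion for tilings, and decidable predicates as
  -- subsets.

  module _ {c ℓ} (G : AbelianGroup c ℓ) where
    open AbelianGroup G using (Carrier)

    Tiling-resp-≐ : ∀ {p q p′ q′} {A : Pred Carrier p} {B : Pred Carrier q}
                    {A′ : Pred Carrier p′} {B′ : Pred Carrier q′} →
                    A ≐ A′ → B ≐ B′ → Tiling G A B → Tiling G A′ B′
    Tiling-resp-≐ (A⊆ , ⊆A) (B⊆ , ⊆B) tiling g with tiling g
    ... | ab , (a∈ , b∈ , eq) , unique =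
      ab , (A⊆ a∈ , B⊆ b∈ , eq) , λ (a∈′ , b∈′ , eq′) → unique (⊆A a∈′ , ⊆B b∈′ , eq′)

    NonPeriodic-resp-≐ : ∀ {p q} {B : Pred Carrier p} {B′ : Pred Carrier q} →
                         B ≐ B′ → NonPeriodic G B → NonPeriodic G B′
    NonPeriodic-resp-≐ (B⊆ , ⊆B) np (g , g≢ε , (t⊆ , ⊆t)) =
      np (g , g≢ε , (λ (b , b∈ , eq) → ⊆B (t⊆ (b , B⊆ b∈ , eq))) ,
                     λ x∈ → let b , b∈ , eq = ⊆t (B⊆ x∈) in b , ⊆B b∈ , eq)

  module _ .{{_ : NonZero N}} where

    -- In `g` = `a ⊞ b` the summand `b` is forced to be `g ⊟ a`, so only the choice of `a` has to be
    -- examined.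
    tiling-from-differences : ∀ {p q} {A : Pred (Fin N) p} {B : Pred (Fin N) q} →
      (∀ g → ∃ λ a → A a × B (g ⊟ a)) →
      (∀ g {a a′} → A a → A a′ → B (g ⊟ a) → B (g ⊟ a′) → a ≡ a′) →
      Tiling (ℤ/ N) A B
    tiling-from-differences {A = A} {B} exists unique g with exists g
    ... | a , a∈A , b∈B =
      (a , g ⊟ a) , (a∈A , b∈B , sym (trans (⊞-comm a (g ⊟ a)) (⊟-⊞ g a))) , rest
      where
      rest : ∀ {ab} → A (proj₁ ab) × B (proj₂ ab) × g ≡ proj₁ ab ⊞ proj₂ ab →
             a ≡ proj₁ ab × g ⊟ a ≡ proj₂ ab
      rest {a′ , b′} (a′∈A , b′∈B , eq) = a≡a′ , trans (cong (g ⊟_) a≡a′) (sym b′≡)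
        where
        b′≡ : b′ ≡ g ⊟ a′
        b′≡ = ⊞≡⇒≡⊟ b′ a′ (trans (⊞-comm b′ a′) (sym eq))
        a≡a′ : a ≡ a′
        a≡a′ = unique g a∈A a′∈A b∈B (subst B b′≡ b′∈B)

  subset : ∀ {p} {P : Pred (Fin N) p} → Decidable P → Subset N
  subset P? = tabulate (λ x → does (P? x))

  module _ {p} {P : Pred (Fin N) p} (P? : Decidable P) where

    subset-≐ : P ≐ (_∈ subset P?)
    subset-≐ =
      (λ {x} px → lookup⇒[]= x _ (trans (lookup∘tabulate _ x) (dec-true (P? x) px))) ,
      (λ {x} x∈ → does-complete (P? x) (trans (sym (lookup∘tabulate _ x)) ([]=⇒lookup x∈)))
      where
      does-complete : ∀ {q} {Q : Set q} (Q? : Dec Q) → does Q? ≡ true → Q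
      does-complete (yes q) _ = q

  -- The finite pattern behind the construction, with its properties checked exhaustively.

  opaque
    -- Membership in the second tile, in terms of the residue mod 8, the residue mod 3 and the value
    -- of `s` at the row of the element. The facts in the next block are all that is used about it.
    β : Fin 8 → Fin 3 → Fin 2 → Bool
    β 0F 0F 0F = true
    β 4F 0F 0F = true
    β 2F 0F 1F = true
    β 6F 0F 1F = true
    β 1F 0F _  = true
    β 5F 1F _  = true
    β _  _  _  = false

  -- `α₈` and `α₃` are the residues of the elements of the first tile, in the form in which
  -- `π₈-point` and `π₃-point` produce them.
  α₈ : Fin 2 → Fin 8
  α₈ i = (2 * toℕ i) mod 8

  α₃ : Fin 3 → Fin 3
  α₃ t = toℕ t mod 3

  opaque
    unfolding β

    -- The three values of `s` are independent because subtracting different `t` may lead to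
    -- different rows. For even `u` take `t` = `c`; then `i` exists because {2s, 4+2s} + {0,2} is
    -- the set of all even residues mod 8. For odd `u`, {1,5} + {0,2} is the set of all odd
    -- residues, which fixes `i` and then `t`.
    β-difference-exists : ∀ u c s₀ s₁ s₂ → ∃₂ λ i t →
      β (u ⊟ α₈ i) (c ⊟ α₃ t) (lookup (s₀ ∷ s₁ ∷ s₂ ∷ []) t) ≡ true
    β-difference-exists = from-yes
      (all? λ u → all? λ c → all? λ s₀ → all? λ s₁ → all? λ s₂ → any? λ i → any? λ t →
       β (u ⊟ α₈ i) (c ⊟ α₃ t) (lookup (s₀ ∷ s₁ ∷ s₂ ∷ []) t) Bool.≟ true)

    -- For even `u` the column forces `t`, but `i` depends on the value of `s`; hence the proviso
    -- `s ≡ s′`, which becomes available once `t ≡ t′` is known.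
    β-difference-unique : ∀ u c i i′ t t′ s s′ →
      β (u ⊟ α₈ i) (c ⊟ α₃ t) s ≡ true → β (u ⊟ α₈ i′) (c ⊟ α₃ t′) s′ ≡ true →
      t ≡ t′ × (s ≡ s′ → i ≡ i′)
    β-difference-unique = from-yes
      (all? λ u → all? λ c → all? λ i → all? λ i′ → all? λ t → all? λ t′ → all? λ s → all? λ s′ →
       (β (u ⊟ α₈ i) (c ⊟ α₃ t) s Bool.≟ true) →-dec (β (u ⊟ α₈ i′) (c ⊟ α₃ t′) s′ Bool.≟ true) →-dec
       ((t ≟ t′) ×-dec ((s ≟ s′) →-dec (i ≟ i′))))

    -- Here `u` and `c` are the residues of a supposed period. An odd `u` would require both column
    -- `c` and column `c` + 1 to be 0, so 1 + `u` is odd and must be 1 or 5. If it is 5, then `c`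
    -- would have to be both 1 and 2. So `u` = 0, and the point with residue 2 demands `s` = 1. The
    -- last point has its own `s′` because it may fall into another row.
    β-period : ∀ u c s s′ →
      β (2F ⊞ u) (0F ⊞ c) s ≡ true → β (6F ⊞ u) (0F ⊞ c) s ≡ true →
      β (1F ⊞ u) (0F ⊞ c) s ≡ true → β (5F ⊞ u) (1F ⊞ c) s′ ≡ true →
      u ≡ 0F × s ≡ 1F
    β-period = from-yes
      (all? λ u → all? λ c → all? λ s → all? λ s′ →
       (β (2F ⊞ u) (0F ⊞ c) s Bool.≟ true) →-dec (β (6F ⊞ u) (0F ⊞ c) s Bool.≟ true) →-dec
       (β (1F ⊞ u) (0F ⊞ c) s Bool.≟ true) →-dec (β (5F ⊞ u) (1F ⊞ c) s′ Bool.≟ true) →-dec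
       ((u ≟ 0F) ×-dec (s ≟ 1F)))

    β-column-2 : ∀ u c s → 2F ≡ u ⊞ 0F → β u c s ≡ true → s ≡ 1F
    β-column-2 = from-yes
      (all? λ u → all? λ c → all? λ s → (2F ≟ u ⊞ 0F) →-dec (β u c s Bool.≟ true) →-dec (s ≟ 1F))

    β-2-0-injective : ∀ s s′ → (β 2F 0F s ≡ true → β 2F 0F s′ ≡ true) →
                      (β 2F 0F s′ ≡ true → β 2F 0F s ≡ true) → s ≡ s′
    β-2-0-injective = from-yes (all? λ s → all? λ s′ →
      ((β 2F 0F s Bool.≟ true) →-dec (β 2F 0F s′ Bool.≟ true)) →-dec
      ((β 2F 0F s′ Bool.≟ true) →-dec (β 2F 0F s Bool.≟ true)) →-dec (s ≟ s′))

    β-5-1 : ∀ s → β 5F 1F s ≡ true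
    β-5-1 _ = refl

    β-1-0 : ∀ s → β 1F 0F s ≡ true
    β-1-0 _ = refl

    β-2-0-1 : β 2F 0F 1F ≡ true
    β-2-0-1 = refl

    β-6-0-1 : β 6F 0F 1F ≡ true
    β-6-0-1 = refl

    α₈-period : ∀ u i i′ → u ≡ α₈ i → α₈ i′ ⊞ u ≡ 0F → u ≡ 0F
    α₈-period = from-yes
      (all? λ u → all? λ i → all? λ i′ → (u ≟ α₈ i) →-dec (α₈ i′ ⊞ u ≟ 0F) →-dec (u ≟ 0F))

  -- Opaque because unfolding these numerals inside _mod_ exhausts memory.
  opaque
    L K : ℕ → ℕ
    L w = 33 + 24 * w
    K w = 8 * L w

    L≡ : ∀ w → L w ≡ 33 + 24 * w
    L≡ w = refl

    K≡ : ∀ w → K w ≡ L w * 8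
    K≡ w = ℕₚ.*-comm 8 (L w)

  instance
    L≢0 : ∀ {w} → NonZero (L w)
    L≢0 {w} = subst NonZero (sym (L≡ w)) _

    K≢0 : ∀ {w} → NonZero (K w)
    K≢0 {w} = subst NonZero (sym (K≡ w)) (ℕₚ.m*n≢0 (L w) 8)

  -- Chinese remainder coordinates on ℤ/8ℓ.

  module Construction (w : ℕ) where

    ℓ ν : ℕ
    ℓ = L w
    ν = K w

    8∣ν : 8 ∣ ν
    8∣ν = divides ℓ (K≡ w)

    ℓ∣ν : ℓ ∣ ν
    ℓ∣ν = divides 8 (trans (K≡ w) (ℕₚ.*-comm ℓ 8))

    -- ℤ/ℓ splits into 11 + 8w rows of three elements, and the residue mod 3 is well defined on it,
    -- also across the wrap-around.
    ℓ≡k*3 : ℓ ≡ (11 + 8 * w) * 3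
    ℓ≡k*3 = trans (L≡ w) (eq w)
      where
      eq : ∀ w → 33 + 24 * w ≡ (11 + 8 * w) * 3
      eq = solve-∀

    ℓ≡1+k*8 : ℓ ≡ 1 + (4 + 3 * w) * 8
    ℓ≡1+k*8 = trans (L≡ w) (eq w)
      where
      eq : ∀ w → 33 + 24 * w ≡ 1 + (4 + 3 * w) * 8
      eq = solve-∀

    3∣ν : 3 ∣ ν
    3∣ν = ∣-trans (divides (11 + 8 * w) ℓ≡k*3) ℓ∣ν

    opaque
      -- As ℓ ≡ 1 mod 8, this is the element with residues u mod 8 and v mod ℓ.
      point : ℕ → ℕ → Fin ν
      point u v = (u * ℓ + v * (1 + 7 * ℓ)) mod ν

      point-0-0 : point 0 0 ≡ 0 mod ν
      point-0-0 = refl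

      π₈-point : ∀ u v → π 8 (point u v) ≡ u mod 8
      π₈-point u v = trans (π-mod 8∣ν _)
        (%⇒mod {k = u * ℓ + v * (1 + 7 * ℓ)} {u} (trans
          (cong (_% 8) (trans (cong (λ x → u * x + v * (1 + 7 * x)) ℓ≡1+k*8) (eq u v (4 + 3 * w))))
          ([m+kn]%n≡m%n u (u * (4 + 3 * w) + v * (1 + 7 * (4 + 3 * w))) 8)))
        where
        eq : ∀ u v k → u * (1 + k * 8) + v * (1 + 7 * (1 + k * 8)) ≡ u + (u * k + v * (1 + 7 * k)) * 8
        eq = solve-∀

      πℓ-point : ∀ u v → π ℓ (point u v) ≡ v mod ℓ
      πℓ-point u v = trans (π-mod ℓ∣ν _)
        (%⇒mod {k = u * ℓ + v * (1 + 7 * ℓ)} {v} (trans (cong (_% ℓ) (eq u v ℓ))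
          ([m+kn]%n≡m%n v (u + v * 7) ℓ)))
        where
        eq : ∀ u v x → u * x + v * (1 + 7 * x) ≡ v + (u + v * 7) * x
        eq = solve-∀

      π₃-point : ∀ u v → π 3 (point u v) ≡ v mod 3
      π₃-point u v = trans (π-mod 3∣ν _)
        (%⇒mod {k = u * ℓ + v * (1 + 7 * ℓ)} {v} (trans
          (cong (_% 3) (trans (cong (λ x → u * x + v * (1 + 7 * x)) ℓ≡k*3) (eq u v (11 + 8 * w))))
          ([m+kn]%n≡m%n v (u * (11 + 8 * w) + v * (7 * (11 + 8 * w))) 3)))
        where
        eq : ∀ u v k → u * (k * 3) + v * (1 + 7 * (k * 3)) ≡ v + (u * k + v * (7 * k)) * 3
        eq = solve-∀

      -- Since 1 + 7ℓ = 8`e`, replacing the two remainders of x by x itself changes the value by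
      -- multiples of 8ℓ only, and xℓ + x(1 + 7ℓ) = x + x · 8ℓ.
      point-π : ∀ x → point (toℕ (π 8 x)) (toℕ (π ℓ x)) ≡ x
      point-π x = begin
        point (toℕ (π 8 x)) (toℕ (π ℓ x))  ≡⟨ cong₂ point (toℕ-mod {8} (toℕ x)) (toℕ-mod {ℓ} (toℕ x)) ⟩
        point r s                          ≡⟨ %⇒mod {ν} {r * ℓ + s * (1 + 7 * ℓ)} {toℕ x} congruent ⟩
        toℕ x mod ν                        ≡⟨ toℕ-mod-inverse x ⟩
        x                                  ∎
        where
        open ≡-Reasoning
        r s q p e : ℕ
        r = toℕ x % 8
        q = toℕ x / 8
        s = toℕ x % ℓ
        p = toℕ x / ℓ
        e = 29 + 21 * w
        1+7ℓ≡8e : 1 + 7 * ℓ ≡ 8 * e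
        1+7ℓ≡8e = trans (cong (λ x → 1 + 7 * x) (L≡ w)) (eq w)
          where
          eq : ∀ w → 1 + 7 * (33 + 24 * w) ≡ 8 * (29 + 21 * w)
          eq = solve-∀
        distribute : ∀ r s q p e l →
          r * l + s * (8 * e) + (q + p * e) * (l * 8) ≡ (r + q * 8) * l + (s + p * l) * (8 * e)
        distribute = solve-∀
        collect : ∀ x l → x * l + x * (1 + 7 * l) ≡ x + x * (l * 8)
        collect = solve-∀
        congruent : (r * ℓ + s * (1 + 7 * ℓ)) % ν ≡ toℕ x % ν
        congruent = begin
          (r * ℓ + s * (1 + 7 * ℓ)) % ν                        ≡⟨ cong (λ y → (r * ℓ + s * y) % ν) 1+7ℓ≡8e ⟩
          (r * ℓ + s * (8 * e)) % ν                            ≡⟨ [m+kn]%n≡m%n (r * ℓ + s * (8 * e)) (q + p * e) ν ⟨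
          (r * ℓ + s * (8 * e) + (q + p * e) * ν) % ν          ≡⟨ cong (_% ν) (trans (cong (λ z → r * ℓ + s * (8 * e) + (q + p * e) * z) (K≡ w)) (distribute r s q p e ℓ)) ⟩
          ((r + q * 8) * ℓ + (s + p * ℓ) * (8 * e)) % ν        ≡⟨ cong₂ (λ a b → (a * ℓ + b * (8 * e)) % ν) (m≡m%n+[m/n]*n (toℕ x) 8) (m≡m%n+[m/n]*n (toℕ x) ℓ) ⟨
          (toℕ x * ℓ + toℕ x * (8 * e)) % ν                    ≡⟨ cong (λ y → (toℕ x * ℓ + toℕ x * y) % ν) 1+7ℓ≡8e ⟨
          (toℕ x * ℓ + toℕ x * (1 + 7 * ℓ)) % ν                ≡⟨ cong (_% ν) (trans (collect (toℕ x) ℓ) (cong (λ z → toℕ x + toℕ x * z) (sym (K≡ w)))) ⟩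
          (toℕ x + toℕ x * ν) % ν                              ≡⟨ [m+kn]%n≡m%n (toℕ x) (toℕ x) ν ⟩
          toℕ x % ν                                            ∎

    ≡0-from-π : ∀ x → π 8 x ≡ 0F → toℕ (π ℓ x) ≡ 0 → x ≡ 0 mod ν
    ≡0-from-π x eq₈ eqℓ = trans (sym (point-π x)) (trans (cong₂ point (cong toℕ eq₈) eqℓ) point-0-0)

    -- The two tiles and the tiling property.

    corner : Fin 2 → Fin 3 → Fin ν
    corner i t = point (2 * toℕ i) (toℕ t)

    InA : Pred (Fin ν) _
    InA x = ∃₂ λ i t → x ≡ corner i t

    row : Fin ν → ℕ
    row x = toℕ (π ℓ x) / 3

    InB : (ℕ → Fin 2) → Pred (Fin ν) _
    InB s x = β (π 8 x) (π 3 x) (s (row x)) ≡ true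

    InA? : Decidable InA
    InA? x = any? λ i → any? λ t → x ≟ corner i t

    InB? : ∀ s → Decidable (InB s)
    InB? s x = β (π 8 x) (π 3 x) (s (row x)) Bool.≟ true

    -- The index `i` moves only the coordinate mod 8. So the value of `s` that is met depends on `t`
    -- alone, which lets the finite checks apply.
    row-⊟-corner : ∀ g i i′ t → row (g ⊟ corner i t) ≡ row (g ⊟ corner i′ t)
    row-⊟-corner g i i′ t = cong (λ x → toℕ x / 3) (begin
      π ℓ (g ⊟ corner i t)        ≡⟨ π-⊟ ℓ∣ν g (corner i t) ⟩
      π ℓ g ⊟ π ℓ (corner i t)    ≡⟨ cong (π ℓ g ⊟_) (πℓ-point (2 * toℕ i) (toℕ t)) ⟩
      π ℓ g ⊟ (toℕ t mod ℓ)       ≡⟨ cong (π ℓ g ⊟_) (πℓ-point (2 * toℕ i′) (toℕ t)) ⟨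
      π ℓ g ⊟ π ℓ (corner i′ t)   ≡⟨ π-⊟ ℓ∣ν g (corner i′ t) ⟨
      π ℓ (g ⊟ corner i′ t)       ∎)
      where open ≡-Reasoning

    β-⊟-corner : ∀ g i t s → β (π 8 (g ⊟ corner i t)) (π 3 (g ⊟ corner i t)) s ≡
                             β (π 8 g ⊟ α₈ i) (π 3 g ⊟ α₃ t) s
    β-⊟-corner g i t s = cong₂ (λ u c → β u c s)
      (trans (π-⊟ 8∣ν g (corner i t)) (cong (π 8 g ⊟_) (π₈-point (2 * toℕ i) (toℕ t))))
      (trans (π-⊟ 3∣ν g (corner i t)) (cong (π 3 g ⊟_) (π₃-point (2 * toℕ i) (toℕ t))))

    tiling : ∀ s → Tiling (ℤ/ ν) InA (InB s)
    tiling s = tiling-from-differences exists unique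
      where
      exists : ∀ g → ∃ λ a → InA a × InB s (g ⊟ a)
      exists g = corner i t , (i , t , refl) ,
        trans (β-⊟-corner g i t _)
          (trans (cong (β _ _) (trans (cong s (row-⊟-corner g i 0F t)) (sym (lookup∘tabulate shift t)))) found)
        where
        -- The values of `s` must be supplied before `i` is found, so they are read off at `0F`;
        -- `row-⊟-corner` transports them to the `i` found afterwards.
        shift : Fin 3 → Fin 2
        shift t = s (row (g ⊟ corner 0F t))
        solution = β-difference-exists (π 8 g) (π 3 g) (shift 0F) (shift 1F) (shift 2F)
        i = proj₁ solution
        t = proj₁ (proj₂ solution)
        found = proj₂ (proj₂ solution)

      unique : ∀ g {a a′} → InA a → InA a′ → InB s (g ⊟ a) → InB s (g ⊟ a′) → a ≡ a′
      unique g (i , t , refl) (i′ , t′ , refl) b∈ b′∈ =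
        -- The equality of `t` and `t′` comes first: it makes the two rows equal, hence the values
        -- of `s`, and only then does `i` agree with `i′`.
        cong₂ corner (proj₂ same (cong s (trans (row-⊟-corner g i i′ t)
          (cong (λ t → row (g ⊟ corner i′ t)) (proj₁ same))))) (proj₁ same)
        where
        same : t ≡ t′ × (s (row (g ⊟ corner i t)) ≡ s (row (g ⊟ corner i′ t′)) → i ≡ i′)
        same = β-difference-unique (π 8 g) (π 3 g) i i′ t t′ _ _
          (trans (sym (β-⊟-corner g i t _)) b∈) (trans (sym (β-⊟-corner g i′ t′ _)) b′∈)

    -- Non-periodicity of both tiles.

    -- As 0 lies in the tile, a period `g` and its inverse `b` both lie there. Mod 8 both are in
    -- {0,2}, which forces 0; mod ℓ both have representatives at most 2, and 4 < ℓ excludes a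
    -- wrap-around.
    A-nonPeriodic : NonPeriodic (ℤ/ ν) InA
    A-nonPeriodic (g , g≢0 , (t⊆ , ⊆t)) = g≢0 (≡0-from-π g π₈≡0 πℓ≡0)
      where
      0∈A : InA (0 mod ν)
      0∈A = 0F , 0F , sym point-0-0
      g∈A : InA g
      g∈A = t⊆ (0 mod ν , 0∈A , sym (AbelianGroup.identityˡ (ℤ/ ν) g))
      inverse : ∃ λ b → InA b × 0 mod ν ≡ b ⊞ g
      inverse = ⊆t 0∈A
      π₈≡0 : π 8 g ≡ 0F
      π₈≡0 with g∈A | inverse
      ... | i , t , eq | b , (i′ , t′ , refl) , 0≡ =
        α₈-period (π 8 g) i i′ (trans (cong (π 8) eq) (π₈-point (2 * toℕ i) (toℕ t)))
          (begin
            α₈ i′ ⊞ π 8 g                  ≡⟨ cong (_⊞ π 8 g) (π₈-point (2 * toℕ i′) (toℕ t′)) ⟨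
            π 8 (corner i′ t′) ⊞ π 8 g     ≡⟨ π-⊞ 8∣ν _ g ⟨
            π 8 (corner i′ t′ ⊞ g)         ≡⟨ cong (π 8) 0≡ ⟨
            π 8 (0 mod ν)                  ≡⟨ π-mod 8∣ν 0 ⟩
            0F                             ∎)
        where open ≡-Reasoning
      πℓ-bound : ∀ {x} → InA x → toℕ (π ℓ x) ≤ 2
      πℓ-bound (i , t , refl) = begin
        toℕ (π ℓ (corner i t))  ≡⟨ cong toℕ (πℓ-point (2 * toℕ i) (toℕ t)) ⟩
        toℕ (toℕ t mod ℓ)       ≡⟨ toℕ-mod (toℕ t) ⟩
        toℕ t % ℓ               ≤⟨ m%n≤m (toℕ t) ℓ ⟩
        toℕ t                   ≤⟨ ℕ.s≤s⁻¹ (toℕ<n t) ⟩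
        2                       ∎
        where open ℕₚ.≤-Reasoning
      πℓ≡0 : toℕ (π ℓ g) ≡ 0
      πℓ≡0 with inverse
      ... | b , b∈A , 0≡ = proj₂ (⊞≡0⇒≡0 (π ℓ b) (π ℓ g)
        (trans (sym (π-⊞ ℓ∣ν b g)) (trans (cong (π ℓ) (sym 0≡)) (π-mod ℓ∣ν 0)))
        (ℕₚ.≤-<-trans (ℕₚ.+-mono-≤ (πℓ-bound b∈A) (πℓ-bound g∈A))
          (subst (4 ℕ.<_) (sym (L≡ w)) (ℕₚ.m≤m+n 5 (28 + 24 * w)))))

    point∈B : ∀ s u v {x} → s (toℕ (v mod ℓ) / 3) ≡ x → β (u mod 8) (v mod 3) x ≡ true →
              InB s (point u v)
    point∈B s u v {x} eq β≡ = trans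
      (cong₂ (λ a c → β a c (s (row (point u v)))) (π₈-point u v) (π₃-point u v))
      (trans (cong (β _ _) (trans (cong (λ y → s (toℕ y / 3)) (πℓ-point u v)) eq)) β≡)

    -- Shifting (2,0), (6,0), (1,0) and (5,1) by a period `g` shows that `g` is 0 mod 8 and lies in
    -- a row where `s` is 1. Writing (2,0) as `b ⊞ g` puts `b` into such a row as well. Both
    -- coordinates mod ℓ are then below ℓ/2 and add up to 0 without wrapping, so `g` vanishes.
    B-nonPeriodic : ∀ s → s 0 ≡ 1F → (∀ j → s j ≡ 1F → j ℕ.< 2 + w) → NonPeriodic (ℤ/ ν) (InB s)
    B-nonPeriodic s s0 support (g , g≢0 , (t⊆ , ⊆t)) = g≢0 (≡0-from-π g (proj₁ period) (proj₂ πℓ≡0))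
      where
      s-row₀ : s (toℕ (0 mod ℓ) / 3) ≡ 1F
      s-row₀ = trans (cong (λ j → s (j / 3)) (trans (toℕ-mod 0) (m<n⇒m%n≡m (ℕ.>-nonZero⁻¹ ℓ)))) s0
      2∈B : InB s (point 2 0)
      2∈B = point∈B s 2 0 s-row₀ β-2-0-1
      shifted : ∀ u v → InB s (point u v) →
                β ((u mod 8) ⊞ π 8 g) ((v mod 3) ⊞ π 3 g) (s (row (point u v ⊞ g))) ≡ true
      shifted u v p∈B = trans
        (sym (cong₂ (λ a c → β a c (s (row (point u v ⊞ g))))
          (trans (π-⊞ 8∣ν (point u v) g) (cong (_⊞ π 8 g) (π₈-point u v)))
          (trans (π-⊞ 3∣ν (point u v) g) (cong (_⊞ π 3 g) (π₃-point u v)))))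
        (t⊆ (point u v , p∈B , refl))
      row-shifted : ∀ u → row (point u 0 ⊞ g) ≡ row g
      row-shifted u = cong (λ x → toℕ x / 3) (begin
        π ℓ (point u 0 ⊞ g)         ≡⟨ π-⊞ ℓ∣ν (point u 0) g ⟩
        π ℓ (point u 0) ⊞ π ℓ g     ≡⟨ cong (_⊞ π ℓ g) (πℓ-point u 0) ⟩
        (0 mod ℓ) ⊞ π ℓ g           ≡⟨ AbelianGroup.identityˡ (ℤ/ ℓ) (π ℓ g) ⟩
        π ℓ g                       ∎)
        where open ≡-Reasoning
      shifted₀ : ∀ u → InB s (point u 0) → β ((u mod 8) ⊞ π 8 g) (0F ⊞ π 3 g) (s (row g)) ≡ true
      shifted₀ u p∈B = subst (λ j → β ((u mod 8) ⊞ π 8 g) (0F ⊞ π 3 g) (s j) ≡ true) (row-shifted u) (shifted u 0 p∈B)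
      period : π 8 g ≡ 0F × s (row g) ≡ 1F
      period = β-period (π 8 g) (π 3 g) (s (row g)) _
        (shifted₀ 2 2∈B)
        (shifted₀ 6 (point∈B s 6 0 s-row₀ β-6-0-1))
        (shifted₀ 1 (point∈B s 1 0 s-row₀ (β-1-0 1F)))
        (shifted 5 1 (point∈B s 5 1 refl (β-5-1 _)))
      row-bound : ∀ x → s (row x) ≡ 1F → toℕ (π ℓ x) ℕ.< 6 + 3 * w
      row-bound x eq = begin-strict
        toℕ (π ℓ x)                              ≡⟨ m≡m%n+[m/n]*n (toℕ (π ℓ x)) 3 ⟩
        toℕ (π ℓ x) % 3 + row x * 3             <⟨ ℕₚ.+-monoˡ-< _ (m%n<n (toℕ (π ℓ x)) 3) ⟩
        -- The left side computes to `suc (row x) * 3`, so the strict bound on the row number is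
        -- exactly what is needed.
        3 + row x * 3                           ≤⟨ ℕₚ.*-monoˡ-≤ 3 (support (row x) eq) ⟩
        (2 + w) * 3                              ≡⟨ ℕₚ.*-comm (2 + w) 3 ⟩
        3 * (2 + w)                              ≡⟨ ℕₚ.*-distribˡ-+ 3 2 w ⟩
        6 + 3 * w                                ∎
        where open ℕₚ.≤-Reasoning
      πℓ≡0 : toℕ (π ℓ (proj₁ (⊆t 2∈B))) ≡ 0 × toℕ (π ℓ g) ≡ 0
      πℓ≡0 with ⊆t 2∈B
      ... | b , b∈B , 2≡ = ⊞≡0⇒≡0 (π ℓ b) (π ℓ g)
        (trans (sym (π-⊞ ℓ∣ν b g)) (trans (cong (π ℓ) (sym 2≡)) (πℓ-point 2 0)))
        (begin-strict
          toℕ (π ℓ b) + toℕ (π ℓ g)    <⟨ ℕₚ.+-mono-< (row-bound b b-shift) (row-bound g (proj₂ period)) ⟩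
          6 + 3 * w + (6 + 3 * w)      ≤⟨ ℕₚ.m≤m+n _ (21 + 18 * w) ⟩
          6 + 3 * w + (6 + 3 * w) + (21 + 18 * w) ≡⟨ collect w ⟩
          33 + 24 * w                  ≡⟨ L≡ w ⟨
          ℓ                            ∎)
        where
        open ℕₚ.≤-Reasoning
        collect : ∀ w → 6 + 3 * w + (6 + 3 * w) + (21 + 18 * w) ≡ 33 + 24 * w
        collect = solve-∀
        b-shift : s (row b) ≡ 1F
        b-shift = β-column-2 (π 8 b) (π 3 b) (s (row b))
          (trans (sym (π₈-point 2 0)) (trans (cong (π 8) 2≡)
            (trans (π-⊞ 8∣ν b g) (cong (π 8 b ⊞_) (proj₁ period)))))
          b∈B

    -- These points serve as probes for `s`. The bound on `j` keeps 3j below ℓ, so that reduction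
    -- mod ℓ leaves the row number intact.
    InB-2-3j : ∀ s {j} → j ℕ.< 2 + w → InB s (point 2 (j * 3)) ≡ (β 2F 0F (s j) ≡ true)
    InB-2-3j s {j} j< = cong (_≡ true) (begin
      β (π 8 x) (π 3 x) (s (row x))              ≡⟨ cong₂ (λ u c → β u c (s (row x))) (π₈-point 2 (j * 3)) (π₃-point 2 (j * 3)) ⟩
      β 2F ((j * 3) mod 3) (s (row x))           ≡⟨ cong₂ (β 2F) (%⇒mod {k = j * 3} {0} (m*n%n≡0 j 3)) (cong s row≡) ⟩
      β 2F 0F (s j)                               ∎)
      where
      open ≡-Reasoning
      x = point 2 (j * 3)
      bound : j * 3 ℕ.< ℓ
      bound = ℕₚ.<-≤-trans (ℕₚ.*-monoˡ-< 3 j<)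
        (subst ((2 + w) * 3 ≤_) (trans (collect w) (sym (L≡ w))) (ℕₚ.m≤m+n ((2 + w) * 3) (27 + 21 * w)))
        where
        collect : ∀ w → (2 + w) * 3 + (27 + 21 * w) ≡ 33 + 24 * w
        collect = solve-∀
      row≡ : row x ≡ j
      row≡ = begin
        toℕ (π ℓ x) / 3                ≡⟨ cong (λ y → toℕ y / 3) (πℓ-point 2 (j * 3)) ⟩
        toℕ ((j * 3) mod ℓ) / 3        ≡⟨ cong (_/ 3) (trans (toℕ-mod (j * 3)) (m<n⇒m%n≡m bound)) ⟩
        j * 3 / 3                      ≡⟨ m*n/n≡m j 3 ⟩
        j                              ∎

    -- The tiles as subsets, and recovering `s` from its tile.

    A : Subset ν
    A = subset InA?

    B : (ℕ → Fin 2) → Subset ν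
    B s = subset (InB? s)

    -- The point (2,3j) belongs to the tile exactly if `s` is 1 at `j`.
    B≡⇒s≡ : ∀ s s′ {j} → j ℕ.< 2 + w → B s ≡ B s′ → s j ≡ s′ j
    B≡⇒s≡ s s′ {j} j< eq = β-2-0-injective (s j) (s′ j)
      (transfer s s′ eq) (transfer s′ s (sym eq))
      where
      transfer : ∀ s s′ → B s ≡ B s′ → β 2F 0F (s j) ≡ true → β 2F 0F (s′ j) ≡ true
      transfer s s′ eq β≡ = subst id (InB-2-3j s′ j<) (proj₂ (subset-≐ (InB? s′))
        (subst (point 2 (j * 3) ∈_) eq (proj₁ (subset-≐ (InB? s)) (subst id (sym (InB-2-3j s j<)) β≡))))

    tiling-B : ∀ s → Tiling (ℤ/ ν) (_∈ A) (_∈ B s)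
    tiling-B s = Tiling-resp-≐ (ℤ/ ν) (subset-≐ InA?) (subset-≐ (InB? s)) (tiling s)

    nonPeriodic-A : NonPeriodic (ℤ/ ν) (_∈ A)
    nonPeriodic-A = NonPeriodic-resp-≐ (ℤ/ ν) (subset-≐ InA?) A-nonPeriodic

    nonPeriodic-B : ∀ s → s 0 ≡ 1F → (∀ j → s j ≡ 1F → j ℕ.< 2 + w) → NonPeriodic (ℤ/ ν) (_∈ B s)
    nonPeriodic-B s s0 support =
      NonPeriodic-resp-≐ (ℤ/ ν) (subset-≐ (InB? s)) (B-nonPeriodic s s0 support)

    -- A family of pairwise different choices of `s`.

    s₀ : ℕ → Fin 2
    s₀ zero    = 1F
    s₀ (suc _) = 0F

    -- The 1 in row 0 excludes periods, the 1 in row 1 separates the family from `s₀`, and the next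
    -- `w` rows hold the binary digits of `i`. The default 0 afterwards keeps the support below 2 +
    -- `w`.
    digits : Fin (2 ℕ.^ w) → ℕ → Fin 2
    digits i zero          = 1F
    digits i (suc zero)    = 1F
    digits i (suc (suc j)) with j ℕₚ.<? w
    ... | yes j<w = finToFun {2} {w} i (fromℕ< j<w)
    ... | no  _   = 0F

    s₀-support : ∀ j → s₀ j ≡ 1F → j ℕ.< 2 + w
    s₀-support zero _ = ℕ.z<s

    digits-support : ∀ i j → digits i j ≡ 1F → j ℕ.< 2 + w
    digits-support i zero          _ = ℕ.z<s
    digits-support i (suc zero)    _ = ℕ.s<s ℕ.z<s
    digits-support i (suc (suc j)) eq with j ℕₚ.<? w
    ... | yes j<w = ℕ.s<s (ℕ.s<s j<w)
    digits-support i (suc (suc j)) () | no _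

    digits-toℕ : ∀ i j → digits i (2 + toℕ j) ≡ finToFun {2} {w} i j
    digits-toℕ i j with toℕ j ℕₚ.<? w
    ... | yes j<w = cong (finToFun {2} {w} i) (fromℕ<-toℕ j j<w)
    ... | no  j≮w = contradiction (toℕ<n j) j≮w

    digits-injective : ∀ i i′ → (∀ j → j ℕ.< 2 + w → digits i j ≡ digits i′ j) → i ≡ i′
    digits-injective i i′ eq = begin
      i                               ≡⟨ funToFin-finToFin {w} {2} i ⟨
      funToFin {w} {2} (finToFun i)   ≡⟨ funToFin-cong {w} {2} agree ⟩
      funToFin {w} {2} (finToFun i′)  ≡⟨ funToFin-finToFin {w} {2} i′ ⟩
      i′                              ∎
      where
      open ≡-Reasoning
      agree : ∀ j → finToFun {2} {w} i j ≡ finToFun {2} {w} i′ j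
      agree j = trans (sym (digits-toℕ i j))
        (trans (eq (2 + toℕ j) (ℕ.s<s (ℕ.s<s (toℕ<n j)))) (digits-toℕ i′ j))
      funToFin-cong : ∀ {m n} {f g : Fin m → Fin n} → (∀ j → f j ≡ g j) → funToFin f ≡ funToFin g
      funToFin-cong {zero}  _   = refl
      funToFin-cong {suc m} f≗g = cong₂ combine (f≗g zero) (funToFin-cong (λ j → f≗g (suc j)))

    B-injective : Injective _≡_ _≡_ (λ i → B (digits i))
    B-injective {i} {i′} eq =
      digits-injective i i′ (λ j j< → B≡⇒s≡ (digits i) (digits i′) j< eq)

    B≢B₀ : ∀ i → B (digits i) ≢ B s₀
    B≢B₀ i eq = 1F≢0F (B≡⇒s≡ (digits i) s₀ {1} (ℕ.s<s ℕ.z<s) eq)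
      where
      1F≢0F : ¬ _≡_ {A = Fin 2} 1F 0F
      1F≢0F ()

-- Naturals inside the rationals, and monotonicity of products and powers.

module Exponential where
  open import Data.Rational.Base hiding (NonZero; ℚ; 0ℚ; _<_)
  open import Data.Rational.Properties
  open RawSemiringDefs +-*-rawSemiring using (_^_)

  fromℕ-homo-+ : ∀ m n → fromℕ (m ℕ.+ n) ≡ fromℕ m + fromℕ n
  fromℕ-homo-+ m n = toℚᵘ-injective (begin
    toℚᵘ (fromℕ (m ℕ.+ n))            ≈⟨ toℚᵘ-fromℚᵘ (ℚᵘ.mkℚᵘ (+ (m ℕ.+ n)) 0) ⟩
    ℚᵘ.mkℚᵘ (+ (m ℕ.+ n)) 0           ≈⟨ ℚᵘ.*≡* (cong (ℤ._* + 1) (cong₂ ℤ._+_ (sym (ℤₚ.*-identityʳ (+ m))) (sym (ℤₚ.*-identityʳ (+ n))))) ⟩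
    ℚᵘ.mkℚᵘ (+ m) 0 ℚᵘ.+ ℚᵘ.mkℚᵘ (+ n) 0 ≈⟨ ℚᵘₚ.+-cong (toℚᵘ-fromℚᵘ (ℚᵘ.mkℚᵘ (+ m) 0)) (toℚᵘ-fromℚᵘ (ℚᵘ.mkℚᵘ (+ n) 0)) ⟨
    toℚᵘ (fromℕ m) ℚᵘ.+ toℚᵘ (fromℕ n) ≈⟨ toℚᵘ-homo-+ (fromℕ m) (fromℕ n) ⟨
    toℚᵘ (fromℕ m + fromℕ n)          ∎)
    where open ℚᵘₚ.≃-Reasoning

  fromℕ-homo-* : ∀ m n → fromℕ (m ℕ.* n) ≡ fromℕ m * fromℕ n
  fromℕ-homo-* m n = toℚᵘ-injective (begin
    toℚᵘ (fromℕ (m ℕ.* n))            ≈⟨ toℚᵘ-fromℚᵘ (ℚᵘ.mkℚᵘ (+ (m ℕ.* n)) 0) ⟩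
    ℚᵘ.mkℚᵘ (+ (m ℕ.* n)) 0           ≈⟨ ℚᵘ.*≡* (cong (ℤ._* + 1) (ℤₚ.pos-* m n)) ⟩
    ℚᵘ.mkℚᵘ (+ m) 0 ℚᵘ.* ℚᵘ.mkℚᵘ (+ n) 0 ≈⟨ ℚᵘₚ.*-cong (toℚᵘ-fromℚᵘ (ℚᵘ.mkℚᵘ (+ m) 0)) (toℚᵘ-fromℚᵘ (ℚᵘ.mkℚᵘ (+ n) 0)) ⟨
    toℚᵘ (fromℕ m) ℚᵘ.* toℚᵘ (fromℕ n) ≈⟨ toℚᵘ-homo-* (fromℕ m) (fromℕ n) ⟨
    toℚᵘ (fromℕ m * fromℕ n)          ∎)
    where open ℚᵘₚ.≃-Reasoning

  fromℕ-nonNeg : ∀ n → NonNegative (fromℕ n)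
  fromℕ-nonNeg n = normalize-nonNeg n 1

  fromℕ-mono-≤ : ∀ {m n} → m ℕ.≤ n → fromℕ m ≤ fromℕ n
  fromℕ-mono-≤ {m} {n} m≤n = begin
    fromℕ m                        ≡⟨ +-identityʳ (fromℕ m) ⟨
    fromℕ m + 0ℚ                   ≤⟨ +-monoʳ-≤ (fromℕ m) (nonNegative⁻¹ (fromℕ (n ℕ.∸ m)) {{fromℕ-nonNeg (n ℕ.∸ m)}}) ⟩
    fromℕ m + fromℕ (n ℕ.∸ m)      ≡⟨ fromℕ-homo-+ m (n ℕ.∸ m) ⟨
    fromℕ (m ℕ.+ (n ℕ.∸ m))        ≡⟨ cong fromℕ (ℕₚ.m+[n∸m]≡n m≤n) ⟩
    fromℕ n                        ∎
    where open ≤-Reasoning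

  fromℕ*1/ : ∀ n .{{_ : ℕ.NonZero n}} → fromℕ n * (+ 1 / n) ≡ 1ℚ
  fromℕ*1/ n@(suc n-1) = toℚᵘ-injective (begin
    toℚᵘ (fromℕ n * (+ 1 / n))                   ≈⟨ toℚᵘ-homo-* (fromℕ n) (+ 1 / n) ⟩
    toℚᵘ (fromℕ n) ℚᵘ.* toℚᵘ (+ 1 / n)           ≈⟨ ℚᵘₚ.*-cong (toℚᵘ-fromℚᵘ (ℚᵘ.mkℚᵘ (+ n) 0)) (toℚᵘ-fromℚᵘ (ℚᵘ.mkℚᵘ (+ 1) n-1)) ⟩
    ℚᵘ.mkℚᵘ (+ n) 0 ℚᵘ.* ℚᵘ.mkℚᵘ (+ 1) n-1       ≈⟨ ℚᵘ.*≡* (cong (λ x → + suc x) (eq n-1)) ⟩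
    ℚᵘ.1ℚᵘ                                       ∎)
    where
    open ℚᵘₚ.≃-Reasoning
    eq : ∀ x → x ℕ.* 1 ℕ.* 1 ≡ x ℕ.+ 0 ℕ.+ 0
    eq = solve-∀

  *-mono-≤-nonNeg : ∀ {p q r s} → NonNegative p → NonNegative s → p ≤ q → r ≤ s → p * r ≤ q * s
  *-mono-≤-nonNeg {p} {q} {r} {s} 0≤p 0≤s p≤q r≤s =
    ≤-trans (*-monoˡ-≤-nonNeg p {{0≤p}} r≤s) (*-monoʳ-≤-nonNeg s {{0≤s}} p≤q)

  ^-nonNeg : ∀ {p} → NonNegative p → ∀ n → NonNegative (p ^ n)
  ^-nonNeg         0≤p zero    = _
  ^-nonNeg {p = p} 0≤p (suc n) = nonNeg*nonNeg⇒nonNeg p {{0≤p}} (p ^ n) {{^-nonNeg 0≤p n}}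

  ^-monoˡ-≤ : ∀ {p q} → NonNegative p → NonNegative q → p ≤ q → ∀ n → p ^ n ≤ q ^ n
  ^-monoˡ-≤ 0≤p 0≤q p≤q zero    = ≤-refl
  ^-monoˡ-≤ 0≤p 0≤q p≤q (suc n) =
    *-mono-≤-nonNeg 0≤p (^-nonNeg 0≤q n) p≤q (^-monoˡ-≤ 0≤p 0≤q p≤q n)

  -- Majorising the exponential series by a geometric one.

  -- Doubling the base sets free the factor `½ ^ n` that makes the majorant summable.
  fromℕ-2m-^ : ∀ m n → fromℕ ((2 ℕ.* m) ℕ.^ n) * ½ ^ n ≡ fromℕ m ^ n
  fromℕ-2m-^ m zero    = refl
  fromℕ-2m-^ m (suc n) = begin
    fromℕ (2 ℕ.* m ℕ.* x) * (½ * ½ ^ n)            ≡⟨ cong (_* (½ * ½ ^ n)) (trans (fromℕ-homo-* (2 ℕ.* m) x) (cong (_* fromℕ x) (fromℕ-homo-* 2 m))) ⟩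
    fromℕ 2 * fromℕ m * fromℕ x * (½ * ½ ^ n)      ≡⟨ solve 4 (λ t m x h → t :* m :* x :* (con ½ :* h) := (t :* con ½) :* (m :* (x :* h))) refl (fromℕ 2) (fromℕ m) (fromℕ x) (½ ^ n) ⟩
    fromℕ 2 * ½ * (fromℕ m * (fromℕ x * ½ ^ n))    ≡⟨ *-identityˡ _ ⟩
    fromℕ m * (fromℕ x * ½ ^ n)                    ≡⟨ cong (fromℕ m *_) (fromℕ-2m-^ m n) ⟩
    fromℕ m * fromℕ m ^ n                          ∎
    where
    open ≡-Reasoning
    open ℚ-Solver.+-*-Solver
    x = (2 ℕ.* m) ℕ.^ n

  -- Up to `n` = `m` the power alone is at most `m ℕ.^ m`. Each later step multiplies the left side
  -- by `m` and the right side by a factor of at least `m`.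
  m^n≤m^m*n! : ∀ m .{{_ : ℕ.NonZero m}} n → m ℕ.^ n ℕ.≤ m ℕ.^ m ℕ.* n !
  m^n≤m^m*n! m n with ℕₚ.≤-total n m
  ... | inj₁ n≤m = ℕₚ.≤-trans (ℕₚ.^-monoʳ-≤ m n≤m) (ℕₚ.m≤m*n (m ℕ.^ m) (n !) {{n ℕₚ.!≢0}})
  m^n≤m^m*n! m zero    | inj₂ m≤n = ℕₚ.≤-trans (ℕₚ.m^n>0 m m) (ℕₚ.≤-reflexive (sym (ℕₚ.*-identityʳ _)))
  m^n≤m^m*n! m (suc n) | inj₂ m≤n = begin
    m ℕ.* m ℕ.^ n                    ≤⟨ ℕₚ.*-mono-≤ m≤n (m^n≤m^m*n! m n) ⟩
    suc n ℕ.* (m ℕ.^ m ℕ.* n !)      ≡⟨ swap (suc n) (m ℕ.^ m) (n !) ⟩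
    m ℕ.^ m ℕ.* (suc n ℕ.* n !)      ∎
    where
    open ℕₚ.≤-Reasoning
    swap : ∀ a b c → a ℕ.* (b ℕ.* c) ≡ b ℕ.* (a ℕ.* c)
    swap = solve-∀

  module _ (m : ℕ) .{{_ : ℕ.NonZero m}} {r} (0≤r : 0ℚ ≤ r) (r≤m : r ≤ fromℕ m) where
    open ≤-Reasoning

    private
      M : ℚ
      M = fromℕ ((2 ℕ.* m) ℕ.^ (2 ℕ.* m))

      instance
        2m≢0 : ℕ.NonZero (2 ℕ.* m)
        2m≢0 = ℕₚ.m*n≢0 2 m

      M-nonNeg : NonNegative M
      M-nonNeg = fromℕ-nonNeg ((2 ℕ.* m) ℕ.^ (2 ℕ.* m))

      ½^-nonNeg : ∀ n → NonNegative (½ ^ n)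
      ½^-nonNeg = ^-nonNeg {½} _

    term-≤ : ∀ n → r ^ n * (_/_ (+ 1) (n !) {{n ℕₚ.!≢0}}) ≤ M * ½ ^ n
    term-≤ n = begin
      r ^ n * 1/n!                                  ≤⟨ *-monoʳ-≤-nonNeg 1/n! {{1/n!-nonNeg}} (^-monoˡ-≤ (nonNegative 0≤r) (fromℕ-nonNeg m) r≤m n) ⟩
      fromℕ m ^ n * 1/n!                            ≡⟨ cong (_* 1/n!) (fromℕ-2m-^ m n) ⟨
      fromℕ ((2 ℕ.* m) ℕ.^ n) * ½ ^ n * 1/n!        ≤⟨ *-monoʳ-≤-nonNeg 1/n! {{1/n!-nonNeg}} (*-monoʳ-≤-nonNeg (½ ^ n) {{½^-nonNeg n}} (fromℕ-mono-≤ (m^n≤m^m*n! (2 ℕ.* m) n))) ⟩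
      fromℕ (x ℕ.* n !) * ½ ^ n * 1/n!              ≡⟨ cong (λ y → y * ½ ^ n * 1/n!) (fromℕ-homo-* x (n !)) ⟩
      M * fromℕ (n !) * ½ ^ n * 1/n!                ≡⟨ solve 4 (λ a b c d → a :* b :* c :* d := (a :* c) :* (b :* d)) refl M (fromℕ (n !)) (½ ^ n) 1/n! ⟩
      M * ½ ^ n * (fromℕ (n !) * 1/n!)              ≡⟨ cong (M * ½ ^ n *_) (fromℕ*1/ (n !)) ⟩
      M * ½ ^ n * 1ℚ                                ≡⟨ *-identityʳ _ ⟩
      M * ½ ^ n                                     ∎
      where
      open ℚ-Solver.+-*-Solver
      x = (2 ℕ.* m) ℕ.^ (2 ℕ.* m)
      instance
        n!≢0 = n ℕₚ.!≢0
      1/n! = + 1 / n !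
      1/n!-nonNeg : NonNegative 1/n!
      1/n!-nonNeg = normalize-nonNeg 1 (n !)

    -- The second summand is the tail of the geometric majorant from index `n` on. Keeping it on the
    -- left lets the induction close: a new term `M * ½ ^ n` and the new tail together make up the
    -- old tail.
    expSum-telescope : ∀ n → expSum r n + (M + M) * ½ ^ n ≤ M + M
    expSum-telescope zero    = ≤-reflexive (trans (+-identityˡ _) (*-identityʳ _))
    expSum-telescope (suc n) = begin
      expSum r n + t + (M + M) * (½ * ½ ^ n)    ≤⟨ +-monoˡ-≤ _ (+-monoʳ-≤ (expSum r n) (term-≤ n)) ⟩
      expSum r n + M * ½ ^ n + (M + M) * (½ * ½ ^ n) ≡⟨ solve 3 (λ s m h → s :+ m :* h :+ (m :+ m) :* (con ½ :* h) := s :+ (m :+ m) :* h) refl (expSum r n) M (½ ^ n) ⟩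
      expSum r n + (M + M) * ½ ^ n              ≤⟨ expSum-telescope n ⟩
      M + M                                     ∎
      where
      open ℚ-Solver.+-*-Solver
      t = r ^ n * (_/_ (+ 1) (n !) {{n ℕₚ.!≢0}})

    expSum-≤ : ∀ n → expSum r n ≤ fromℕ (2 ℕ.* (2 ℕ.* m) ℕ.^ (2 ℕ.* m))
    expSum-≤ n = begin
      expSum r n                       ≡⟨ +-identityʳ _ ⟨
      expSum r n + 0ℚ                  ≤⟨ +-monoʳ-≤ (expSum r n) (nonNegative⁻¹ ((M + M) * ½ ^ n) {{rest-nonNeg}}) ⟩
      expSum r n + (M + M) * ½ ^ n     ≤⟨ expSum-telescope n ⟩
      M + M                            ≡⟨ fromℕ-homo-+ x x ⟨
      fromℕ (x ℕ.+ x)                  ≡⟨ cong (λ y → fromℕ (x ℕ.+ y)) (ℕₚ.+-identityʳ x) ⟨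
      fromℕ (2 ℕ.* x)                  ∎
      where
      x = (2 ℕ.* m) ℕ.^ (2 ℕ.* m)
      rest-nonNeg : NonNegative ((M + M) * ½ ^ n)
      rest-nonNeg = nonNeg*nonNeg⇒nonNeg (M + M) {{nonNeg+nonNeg⇒nonNeg M {{M-nonNeg}} M {{M-nonNeg}}}}
                      (½ ^ n) {{½^-nonNeg n}}

  -- From the square-root bound to a power of two.

  *-cancel-square-≤ : ∀ {p q} → NonNegative q → p * p ≤ q * q → p ≤ q
  *-cancel-square-≤ {p} {q} 0≤q p²≤q² = ≮⇒≥ λ q<p →
    <-irrefl refl (<-≤-trans
      (≤-<-trans (*-monoˡ-≤-nonNeg q {{0≤q}} (<⇒≤ q<p)) (*-monoˡ-<-pos p {{positive (≤-<-trans (nonNegative⁻¹ q {{0≤q}}) q<p)}} q<p))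
      p²≤q²)

  n≤2^n : ∀ n → n ℕ.≤ 2 ℕ.^ n
  n≤2^n zero    = ℕ.z≤n
  n≤2^n (suc n) = ℕₚ.+-mono-≤ (ℕₚ.m^n>0 2 n) (ℕₚ.≤-trans (n≤2^n n) (ℕₚ.m≤m+n _ 0))

  -- For `w` = 4m² + 1 the modulus is 456 + 768m², at most 1224m² for m ≥ 1, and 1225 = 35² is the
  -- next square.
  1/35 : ℚ
  1/35 = + 1 / 35

  exp-√-≤ : ∀ m .{{_ : ℕ.NonZero m}} {N w} → N ℕ.≤ 1225 ℕ.* (m ℕ.* m) → w ≡ suc (2 ℕ.* m ℕ.* (2 ℕ.* m)) →
            exp (1/35 √ N) ≤ fromℕ (2 ℕ.^ w)
  exp-√-≤ m {N} {w} N≤ refl {r} (0≤r , r²≤) n = ≤-trans (expSum-≤ m 0≤r r≤m n) (fromℕ-mono-≤ bound)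
    where
    r≤m : r ≤ fromℕ m
    r≤m = *-cancel-square-≤ (fromℕ-nonNeg m) (begin
      r * r                                   ≤⟨ r²≤ ⟩
      1/35 * 1/35 * fromℕ N                       ≤⟨ *-monoˡ-≤-nonNeg (1/35 * 1/35) (fromℕ-mono-≤ N≤) ⟩
      1/35 * 1/35 * fromℕ (1225 ℕ.* (m ℕ.* m))    ≡⟨ cong (1/35 * 1/35 *_) (fromℕ-homo-* 1225 (m ℕ.* m)) ⟩
      1/35 * 1/35 * (fromℕ 1225 * fromℕ (m ℕ.* m)) ≡⟨ *-assoc (1/35 * 1/35) (fromℕ 1225) (fromℕ (m ℕ.* m)) ⟨
      -- The product of `1/35 * 1/35` and `fromℕ 1225` evaluates to `1ℚ`.
      1ℚ * fromℕ (m ℕ.* m)                    ≡⟨ *-identityˡ _ ⟩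
      fromℕ (m ℕ.* m)                         ≡⟨ fromℕ-homo-* m m ⟩
      fromℕ m * fromℕ m                       ∎)
      where open ≤-Reasoning
    bound : 2 ℕ.* (2 ℕ.* m) ℕ.^ (2 ℕ.* m) ℕ.≤ 2 ℕ.^ suc (2 ℕ.* m ℕ.* (2 ℕ.* m))
    bound = ℕₚ.*-monoʳ-≤ 2 (begin
      -- The crude bound 2m ≤ 2²ᵐ on the base costs an exponent quadratic in m. That is affordable
      -- because the modulus is quadratic in m too.
      (2 ℕ.* m) ℕ.^ (2 ℕ.* m)             ≤⟨ ℕₚ.^-monoˡ-≤ (2 ℕ.* m) (n≤2^n (2 ℕ.* m)) ⟩
      (2 ℕ.^ (2 ℕ.* m)) ℕ.^ (2 ℕ.* m)     ≡⟨ ℕₚ.^-*-assoc 2 (2 ℕ.* m) (2 ℕ.* m) ⟩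
      2 ℕ.^ (2 ℕ.* m ℕ.* (2 ℕ.* m))       ∎)
      where open ℕₚ.≤-Reasoning

-- Choice of the parameters.

open import Data.Nat.Base using (_≤_)

theorem4p1 : Σ[ C ∈ ℚ ] 0ℚ < C ×
    (∀ (M : ℕ) →
    Σ[ N ∈ ℕ ] Σ[ N≢0 ∈ NonZero N ] M ≤ N ×
    (let G = (ℤ/ N) {{N≢0}} in
    Σ[ A ∈ Subset N ] Σ[ B ∈ Subset N ]
    NonPeriodicTiling G (_∈ A) (_∈ B) ×
    (Σ[ k ∈ ℕ ] Σ[ Bs ∈ (Fin k → Subset N) ]
    Injective _≡_ _≡_ Bs ×
    (∀ i → Bs i ≢ B) ×
    (∀ i → NonPeriodic G (_∈ Bs i)) ×
    (∀ i → Tiling G (_∈ A) (_∈ Bs i)) ×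
    (exp (C √ N) ≤ fromℕ k))))
theorem4p1 = 1/35 , ℚₚ.positive⁻¹ 1/35 , λ M →
  -- The successor makes `m` nonzero, and `w` is the exponent for which 2ʷ dominates eᵐ; the modulus
  -- then exceeds `M`.
  let m = suc M
      w = suc (2 ℕ.* m ℕ.* (2 ℕ.* m))
      open Construction w
  in K w , K≢0 , M≤K M , A , B s₀ ,
     (tiling-B s₀ , nonPeriodic-A , nonPeriodic-B s₀ refl s₀-support) ,
     2 ℕ.^ w , (λ i → B (digits i)) , B-injective , B≢B₀ ,
     (λ i → nonPeriodic-B (digits i) refl (digits-support i)) ,
     (λ i → tiling-B (digits i)) ,
     exp-√-≤ m (K≤1225m² M) refl
  where
  open Tilings
  open Exponential using (1/35; exp-√-≤)

  K≡⁺ : ∀ w → K w ≡ (33 ℕ.+ 24 ℕ.* w) ℕ.* 8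
  K≡⁺ w = trans (K≡ w) (cong (ℕ._* 8) (L≡ w))

  -- The difference of the two sides is a polynomial in `M` with nonnegative coefficients; adding it
  -- explicitly turns the inequality into a ring identity. The same device gives `K≤1225m²`.
  M≤K : ∀ M → M ≤ K (suc (2 ℕ.* suc M ℕ.* (2 ℕ.* suc M)))
  M≤K M = ℕₚ.m+n≤o⇒m≤o M (ℕₚ.≤-reflexive (trans (eq M) (sym (K≡⁺ _))))
    where
    eq : ∀ M → M ℕ.+ (1224 ℕ.+ 1535 ℕ.* M ℕ.+ 768 ℕ.* (M ℕ.* M)) ≡
               (33 ℕ.+ 24 ℕ.* (1 ℕ.+ 2 ℕ.* (1 ℕ.+ M) ℕ.* (2 ℕ.* (1 ℕ.+ M)))) ℕ.* 8
    eq = solve-∀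

  K≤1225m² : ∀ M → K (suc (2 ℕ.* suc M ℕ.* (2 ℕ.* suc M))) ≤ 1225 ℕ.* (suc M ℕ.* suc M)
  K≤1225m² M = ℕₚ.m+n≤o⇒m≤o _ (ℕₚ.≤-reflexive
    (trans (cong (ℕ._+ (1 ℕ.+ 914 ℕ.* M ℕ.+ 457 ℕ.* (M ℕ.* M))) (K≡⁺ _)) (eq M)))
    where
    eq : ∀ M → (33 ℕ.+ 24 ℕ.* (1 ℕ.+ 2 ℕ.* (1 ℕ.+ M) ℕ.* (2 ℕ.* (1 ℕ.+ M)))) ℕ.* 8 ℕ.+
               (1 ℕ.+ 914 ℕ.* M ℕ.+ 457 ℕ.* (M ℕ.* M)) ≡
               1225 ℕ.* ((1 ℕ.+ M) ℕ.* (1 ℕ.+ M))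
    eq = solve-∀
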